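{- Let $k\ge1$ be an integer. If $k$ is even, then $A(3k,k)$ is nonsingular, i.e. $N(3k,k)=0$. If $k\equiv1\pmod4$ then $N(3k,k)=1$, and if $k\equiv3\pmod4$ then $N(3k,k)=3$.
   Context: For $n>k\ge1$, $A(n,k)$ is the $n\times n$ skew-symmetric Toeplitz matrix whose first $k$ superdiagonals have all entries $1$ and whose remaining superdiagonals have all entries $0$, and $N(n,k)$ is its nullity. -}

module Defs where

open import Algebra.Bundles using (CommutativeRing)
open import Data.Bool.Base using (Bool; if_then_else_; _∧_)
open import Data.Fin.Base using (Fin; toℕ)
open import Data.Fin.Properties using (_≟_)
open import Data.Nat.Base using (ℕ; _<ᵇ_; _≤ᵇ_; _∸_)
open import Data.Product.Base using (_×_; ∃-syntax)
open import Data.Rational.Base using (ℚ; 0ℚ; 1ℚ; -_; _*_)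
open import Data.Rational.Properties using (+-*-commutativeRing)
open import Data.Vec.Functional using (Vector)
open import Relation.Binary.PropositionalEquality using (_≡_)
open import Relation.Nullary.Decidable.Core using (does)

open import Algebra.Properties.Semiring.Sum (CommutativeRing.semiring +-*-commutativeRing) using (sum)

-- The matrices have integer entries, so rank and nullity may be taken over ℚ:
-- they are the same over every field of characteristic zero.
Matrix : ℕ → ℕ → Set
Matrix m n = Fin m → Fin n → ℚ

_·ᵥ_ : ∀ {m n} → Matrix m n → Vector ℚ n → Vector ℚ m
(M ·ᵥ x) i = sum (λ j → M i j * x j)

_·ₘ_ : ∀ {l m n} → Matrix l m → Matrix m n → Matrix l n
(M ·ₘ P) i j = sum (λ t → M i t * P t j)

identity : ∀ n → Matrix n n
identity n i j = if does (i ≟ j) then 1ℚ else 0ℚ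

-- Equality of vectors and of matrices is entrywise, as there is no function
-- extensionality.
Nonsingular : ∀ {n} → Matrix n n → Set
Nonsingular {n} M =
  ∃[ P ] (∀ i j → (M ·ₘ P) i j ≡ identity n i j) × (∀ i j → (P ·ₘ M) i j ≡ identity n i j)

InKernel : ∀ {m n} → Matrix m n → Vector ℚ n → Set
InKernel M x = ∀ i → (M ·ᵥ x) i ≡ 0ℚ

linearCombination : ∀ {d n} → Vector ℚ d → (Fin d → Vector ℚ n) → Vector ℚ n
linearCombination c v j = sum (λ s → c s * v s j)

LinearlyIndependent : ∀ {d n} → (Fin d → Vector ℚ n) → Set
LinearlyIndependent {d} v =
  (c : Vector ℚ d) → (∀ j → linearCombination c v j ≡ 0ℚ) → ∀ s → c s ≡ 0ℚ

record IsKernelBasis {m n d} (M : Matrix m n) (v : Fin d → Vector ℚ n) : Set where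
  field
    inKernel    : ∀ s → InKernel M (v s)
    independent : LinearlyIndependent v
    spanning    : ∀ x → InKernel M x → ∃[ c ] (∀ j → linearCombination c v j ≡ x j)

-- "The nullity of M is d": the kernel of M has dimension d.  A relation, which
-- determines d because any two finite bases of a space have the same size.
HasNullity : ∀ {m n} → Matrix m n → ℕ → Set
HasNullity M d = ∃[ v ] IsKernelBasis {d = d} M v

-- onSuperdiagonal k i j is true when 1 ≤ j - i ≤ k.
onSuperdiagonal : ℕ → ℕ → ℕ → Bool
onSuperdiagonal k i j = (i <ᵇ j) ∧ (j ∸ i ≤ᵇ k)

-- Intended for n > k ≥ 1.
A : (n k : ℕ) → Matrix n n
A n k i j =
  if onSuperdiagonal k (toℕ i) (toℕ j) then 1ℚ else
  if onSuperdiagonal k (toℕ j) (toℕ i) then - 1ℚ else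
  0ℚ

{-# OPTIONS --safe #-}
module Submission where

-- Let X be the sequence of prefix sums of x ∈ ℚ³ᵏ, so that row i of A x = 0 reads
-- X(i+k+1) + X(i-k) = X(i+1) + X(i), where X(m) = 0 for m ≤ 0 and X(m) = X(3k) for m ≥ 3k.
-- Extend X(0), …, X(k) to a function P on ℕ of period k+1.  For 0 ≤ i ≤ k the first 2k rows say
--   X(k+i) = P(k+i) + P(i)  and  X(2k+i) = P(2k+i) + P(k+i) + P(i),
-- and modulo k+1 these arguments are consecutive.  The last k rows then say that all sums of four
-- cyclically consecutive values of P equal X(3k), that is, that P also has period 4.
-- So ker A is the space of functions of period gcd(4, k+1) that vanish at 0, of dimension
-- gcd(4, k+1) - 1.

open import Defs
open import Algebra.Bundles using (CommutativeRing)
open import Data.Bool.Base using (true; false; not; if_then_else_)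
open import Data.Fin.Base using (Fin; zero; suc; toℕ; fromℕ<; punchIn)
open import Data.Fin.Properties using (any?; toℕ-fromℕ<; toℕ-injective; toℕ<n)
open import Data.Nat.Base as ℕ using (ℕ; zero; suc; s≤s; z≤n; s<s; _<_; _≤_; _≥_; _<ᵇ_; _∸_; _%_; _/_)
open import Data.Nat.Divisibility using (_∣_; divides; ∣m+n∣m⇒∣n; ∣n⇒∣m*n; ∣m∣n⇒∣m+n; ∣-refl; ∣⇒≤; 1∣_)
open import Data.Nat.DivMod using (m≡m%n+[m/n]*n; m%n<n; [m+n]%n≡m%n; m≤n⇒m%n≡m; _mod_)
open import Data.Nat.GCD using (GCD; module GCD; module Bézout)
import Data.Nat.Properties as ℕ
open import Data.Product.Base using (_×_; _,_; ∃-syntax; proj₁; proj₂)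
open import Data.Rational.Base using (ℚ; 0ℚ; 1ℚ; -_; _+_; _-_; _*_; 1/_; NonZero; ≢-nonZero)
open import Data.Rational.Properties as ℚ using (_≟_; +-*-commutativeRing)
open import Data.Rational.Solver using (module +-*-Solver)
open import Data.Sum.Base using (inj₁; inj₂)
open import Data.Vec.Functional using (Vector; _∷_; tail; insertAt)
open import Data.Vec.Functional.Properties using (insertAt-lookup; insertAt-punchIn)
open import Relation.Binary.PropositionalEquality using (_≡_; _≢_; refl; sym; trans; cong; cong₂; subst; module ≡-Reasoning)
open import Relation.Nullary using (¬?; yes; no)
open import Relation.Nullary.Decidable using (decidable-stable)

open import Algebra.Properties.Group ℚ.+-0-group using (x∙y⁻¹≈ε⇒x≈y; x≈y⇒x∙y⁻¹≈ε; ∙-cancelˡ; ∙-cancelʳ)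
open import Algebra.Properties.Semiring.Sum (CommutativeRing.semiring +-*-commutativeRing) using (sum; sum-cong-≗; sum-remove; ∑-comm; ∑-distrib-+; *-distribˡ-sum; *-distribʳ-sum)

open ≡-Reasoning
open +-*-Solver using (solve; _:+_; _:*_; _:-_; :-_; _:=_; con)

-- Dot products and matrix identities over ℚ.

infix 7 _∙_

_∙_ : ∀ {n} → Vector ℚ n → Vector ℚ n → ℚ
a ∙ x = sum (λ j → a j * x j)

∙-congʳ : ∀ {n} (a : Vector ℚ n) {x y} → (∀ j → x j ≡ y j) → a ∙ x ≡ a ∙ y
∙-congʳ a eq = sum-cong-≗ (λ j → cong (a j *_) (eq j))

∙-congˡ : ∀ {n} {a b : Vector ℚ n} x → (∀ j → a j ≡ b j) → a ∙ x ≡ b ∙ x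
∙-congˡ x eq = sum-cong-≗ (λ j → cong (_* x j) (eq j))

∙-comm : ∀ {n} (a x : Vector ℚ n) → a ∙ x ≡ x ∙ a
∙-comm a x = sum-cong-≗ (λ j → ℚ.*-comm (a j) (x j))

∙-zeroʳ : ∀ {n} (a : Vector ℚ n) → a ∙ (λ _ → 0ℚ) ≡ 0ℚ
∙-zeroʳ {zero}  a = refl
∙-zeroʳ {suc n} a = cong₂ _+_ (ℚ.*-zeroʳ (a zero)) (∙-zeroʳ (tail a))

∙-zeroˡ : ∀ {n} (x : Vector ℚ n) → (λ _ → 0ℚ) ∙ x ≡ 0ℚ
∙-zeroˡ x = trans (∙-comm (λ _ → 0ℚ) x) (∙-zeroʳ x)

neg≡-1* : ∀ p → - p ≡ (- 1ℚ) * p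
neg≡-1* p = solve 1 (λ p → :- p := con (- 1ℚ) :* p) refl p

∙-scaleʳ : ∀ {n} (a : Vector ℚ n) u x → a ∙ (λ j → u * x j) ≡ u * (a ∙ x)
∙-scaleʳ a u x = begin
  a ∙ (λ j → u * x j)         ≡⟨ sum-cong-≗ (λ j → solve 3 (λ a u x → a :* (u :* x) := u :* (a :* x)) refl (a j) u (x j)) ⟩
  sum (λ j → u * (a j * x j)) ≡⟨ *-distribˡ-sum u (λ j → a j * x j) ⟨
  u * (a ∙ x)                 ∎

∙-distribˡ-+ : ∀ {n} (a x y : Vector ℚ n) → a ∙ (λ j → x j + y j) ≡ a ∙ x + a ∙ y
∙-distribˡ-+ a x y = begin
  a ∙ (λ j → x j + y j)             ≡⟨ sum-cong-≗ (λ j → ℚ.*-distribˡ-+ (a j) (x j) (y j)) ⟩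
  sum (λ j → a j * x j + a j * y j) ≡⟨ ∑-distrib-+ (λ j → a j * x j) (λ j → a j * y j) ⟩
  a ∙ x + a ∙ y                     ∎

∙-distribˡ-- : ∀ {n} (a x y : Vector ℚ n) → a ∙ (λ j → x j - y j) ≡ a ∙ x - a ∙ y
∙-distribˡ-- a x y = begin
  a ∙ (λ j → x j - y j)            ≡⟨ ∙-congʳ a (λ j → cong (x j +_) (neg≡-1* (y j))) ⟩
  a ∙ (λ j → x j + (- 1ℚ) * y j)   ≡⟨ ∙-distribˡ-+ a x (λ j → (- 1ℚ) * y j) ⟩
  a ∙ x + a ∙ (λ j → (- 1ℚ) * y j) ≡⟨ cong (a ∙ x +_) (∙-scaleʳ a (- 1ℚ) y) ⟩
  a ∙ x + (- 1ℚ) * (a ∙ y)         ≡⟨ cong (a ∙ x +_) (neg≡-1* (a ∙ y)) ⟨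
  a ∙ x - a ∙ y                    ∎

∙-distribʳ-+ : ∀ {n} (x a b : Vector ℚ n) → (λ j → a j + b j) ∙ x ≡ a ∙ x + b ∙ x
∙-distribʳ-+ x a b = begin
  (λ j → a j + b j) ∙ x ≡⟨ ∙-comm _ x ⟩
  x ∙ (λ j → a j + b j) ≡⟨ ∙-distribˡ-+ x a b ⟩
  x ∙ a + x ∙ b         ≡⟨ cong₂ _+_ (∙-comm x a) (∙-comm x b) ⟩
  a ∙ x + b ∙ x         ∎

∙-distribʳ-- : ∀ {n} (x a b : Vector ℚ n) → (λ j → a j - b j) ∙ x ≡ a ∙ x - b ∙ x
∙-distribʳ-- x a b = begin
  (λ j → a j - b j) ∙ x ≡⟨ ∙-comm _ x ⟩
  x ∙ (λ j → a j - b j) ≡⟨ ∙-distribˡ-- x a b ⟩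
  x ∙ a - x ∙ b         ≡⟨ cong₂ _-_ (∙-comm x a) (∙-comm x b) ⟩
  a ∙ x - b ∙ x         ∎

∙-scaleˡ : ∀ {n} u (a x : Vector ℚ n) → (λ j → u * a j) ∙ x ≡ u * (a ∙ x)
∙-scaleˡ u a x = begin
  (λ j → u * a j) ∙ x ≡⟨ ∙-comm _ x ⟩
  x ∙ (λ j → u * a j) ≡⟨ ∙-scaleʳ x u a ⟩
  u * (x ∙ a)         ≡⟨ cong (u *_) (∙-comm x a) ⟩
  u * (a ∙ x)         ∎

∙-assoc : ∀ {m n} (a : Vector ℚ m) (M : Matrix m n) x →
          a ∙ (λ t → M t ∙ x) ≡ (λ s → a ∙ (λ t → M t s)) ∙ x
∙-assoc a M x = begin
  a ∙ (λ t → M t ∙ x)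
    ≡⟨ sum-cong-≗ (λ t → *-distribˡ-sum (a t) (λ s → M t s * x s)) ⟩
  sum (λ t → sum (λ s → a t * (M t s * x s)))
    ≡⟨ ∑-comm (λ t s → a t * (M t s * x s)) ⟩
  sum (λ s → sum (λ t → a t * (M t s * x s)))
    ≡⟨ sum-cong-≗ (λ s → sum-cong-≗ (λ t → sym (ℚ.*-assoc (a t) (M t s) (x s)))) ⟩
  sum (λ s → sum (λ t → a t * M t s * x s))
    ≡⟨ sum-cong-≗ (λ s → sym (*-distribʳ-sum (x s) (λ t → a t * M t s))) ⟩
  (λ s → a ∙ (λ t → M t s)) ∙ x ∎

∙-identityˡ : ∀ {n} (i : Fin n) x → identity n i ∙ x ≡ x i
∙-identityˡ zero x = begin
  1ℚ * x zero + (λ _ → 0ℚ) ∙ tail x ≡⟨ cong₂ _+_ (ℚ.*-identityˡ (x zero)) (∙-zeroˡ (tail x)) ⟩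
  x zero + 0ℚ                       ≡⟨ ℚ.+-identityʳ (x zero) ⟩
  x zero                            ∎
∙-identityˡ (suc i) x = begin
  0ℚ * x zero + identity _ i ∙ tail x ≡⟨ cong₂ _+_ (ℚ.*-zeroˡ (x zero)) (∙-identityˡ i (tail x)) ⟩
  0ℚ + x (suc i)                      ≡⟨ ℚ.+-identityˡ (x (suc i)) ⟩
  x (suc i)                           ∎

identity-sym : ∀ {n} (i j : Fin n) → identity n i j ≡ identity n j i
identity-sym zero    zero    = refl
identity-sym zero    (suc j) = refl
identity-sym (suc i) zero    = refl
identity-sym (suc i) (suc j) = identity-sym i j

∙-identityʳ : ∀ {n} x (j : Fin n) → x ∙ (λ t → identity n t j) ≡ x j
∙-identityʳ x j = begin
  x ∙ (λ t → identity _ t j) ≡⟨ ∙-comm x _ ⟩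
  (λ t → identity _ t j) ∙ x ≡⟨ ∙-congˡ x (λ t → identity-sym t j) ⟩
  identity _ j ∙ x           ≡⟨ ∙-identityˡ j x ⟩
  x j                        ∎

∙-insertAt : ∀ {n} (a : Vector ℚ (suc n)) j v x →
             a ∙ insertAt x j v ≡ a j * v + (λ t → a (punchIn j t)) ∙ x
∙-insertAt a j v x = begin
  a ∙ insertAt x j v
    ≡⟨ sum-remove {i = j} (λ t → a t * insertAt x j v t) ⟩
  a j * insertAt x j v j + sum (λ t → a (punchIn j t) * insertAt x j v (punchIn j t))
    ≡⟨ cong₂ _+_ (cong (a j *_) (insertAt-lookup x j v))
                 (sum-cong-≗ (λ t → cong (a (punchIn j t) *_) (insertAt-punchIn x j v t))) ⟩
  a j * v + (λ t → a (punchIn j t)) ∙ x ∎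

-- Underdetermined systems, and inverses of matrices with trivial kernel.

*-nonZero : ∀ {a y} → a ≢ 0ℚ → y ≢ 0ℚ → a * y ≢ 0ℚ
*-nonZero {a} {y} a≢0 y≢0 ay≡0 = y≢0 (begin
  y              ≡⟨ ℚ.*-identityˡ y ⟨
  1ℚ * y         ≡⟨ cong (_* y) (ℚ.*-inverseˡ a) ⟨
  1/ a * a * y   ≡⟨ ℚ.*-assoc (1/ a) a y ⟩
  1/ a * (a * y) ≡⟨ cong (1/ a *_) ay≡0 ⟩
  1/ a * 0ℚ      ≡⟨ ℚ.*-zeroʳ (1/ a) ⟩
  0ℚ             ∎)
  where instance
    a-nonZero : NonZero a
    a-nonZero = ≢-nonZero a≢0

-- Gaussian elimination by induction on the number of rows. If row zero is zero it is dropped;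
-- otherwise a nonzero entry in it serves as pivot, its row and column are removed, and a kernel
-- vector of the smaller matrix is lifted back.
nonzeroKernelVector : ∀ {m n} → m < n → (M : Matrix m n) →
                      ∃[ x ] (∃[ j ] x j ≢ 0ℚ) × InKernel M x
nonzeroKernelVector {zero}  {suc n} _ M = (λ _ → 1ℚ) , (zero , λ ()) , λ ()
nonzeroKernelVector {suc m} {suc n} (s<s m<n) M with any? (λ j → ¬? (M zero j ≟ 0ℚ))
... | no M₀≡0 with nonzeroKernelVector (ℕ.m<n⇒m<1+n m<n) (λ i → M (suc i))
...   | x , x≢0 , Mx≡0 = x , x≢0 , λ
  { zero → begin
      M zero ∙ x       ≡⟨ ∙-congˡ x (λ j → decidable-stable (M zero j ≟ 0ℚ) (λ M₀ⱼ≢0 → M₀≡0 (j , M₀ⱼ≢0))) ⟩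
      (λ _ → 0ℚ) ∙ x   ≡⟨ ∙-zeroˡ x ⟩
      0ℚ               ∎
  ; (suc i) → Mx≡0 i }
nonzeroKernelVector {suc m} {suc n} (s<s m<n) M | yes (j , a≢0)
  -- Elimination by cross-multiplication with the pivot `M zero j`, which avoids division.
  with nonzeroKernelVector m<n (λ i t → M zero j * M (suc i) (punchIn j t) - M (suc i) j * M zero (punchIn j t))
... | y , (t , y≢0) , M′y≡0 = x , (punchIn j t , x≢0) , λ
  { zero → begin
      M zero ∙ x            ≡⟨ expand zero ⟩
      a * (- S) + a * S     ≡⟨ solve 2 (λ a s → a :* (:- s) :+ a :* s := con 0ℚ) refl a S ⟩
      0ℚ                    ∎
  ; (suc i) → begin
      M (suc i) ∙ x
        ≡⟨ expand (suc i) ⟩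
      M (suc i) j * (- S) + a * (rest (suc i) ∙ y)
        ≡⟨ solve 4 (λ b s a r → b :* (:- s) :+ a :* r := a :* r :- b :* s) refl (M (suc i) j) S a (rest (suc i) ∙ y) ⟩
      a * (rest (suc i) ∙ y) - M (suc i) j * S
        ≡⟨ cong₂ _-_ (∙-scaleˡ a (rest (suc i)) y) (∙-scaleˡ (M (suc i) j) (rest zero) y) ⟨
      (λ t → a * rest (suc i) t) ∙ y - (λ t → M (suc i) j * rest zero t) ∙ y
        ≡⟨ ∙-distribʳ-- y (λ t → a * rest (suc i) t) (λ t → M (suc i) j * rest zero t) ⟨
      (λ t → a * rest (suc i) t - M (suc i) j * rest zero t) ∙ y
        ≡⟨ M′y≡0 i ⟩
      0ℚ ∎ }
  where
  a = M zero j
  rest : Matrix (suc m) n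
  rest i t = M i (punchIn j t)
  S = rest zero ∙ y
  -- The smaller solution is scaled by the pivot `a`, so that the entry `- S` at column `j` solves
  -- row zero: `a * (- S) + a * S` vanishes.
  x = insertAt (λ t → a * y t) j (- S)
  x≢0 : x (punchIn j t) ≢ 0ℚ
  x≢0 eq = *-nonZero a≢0 y≢0 (trans (sym (insertAt-punchIn (λ t → a * y t) j (- S) t)) eq)
  expand : ∀ i → M i ∙ x ≡ M i j * (- S) + a * (rest i ∙ y)
  expand i = trans (∙-insertAt (M i) j (- S) (λ t → a * y t)) (cong (M i j * (- S) +_) (∙-scaleʳ (rest i) a y))

TrivialKernel : ∀ {m n} → Matrix m n → Set
TrivialKernel M = ∀ x → InKernel M x → ∀ j → x j ≡ 0ℚ

-- A nonzero kernel vector (t , x) of the augmented matrix [ - b | M ] has t ≢ 0, so x / t solves M x = b.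
trivialKernel⇒solvable : ∀ {n} (M : Matrix n n) → TrivialKernel M →
                         ∀ (b : Vector ℚ n) → ∃[ y ] (∀ i → M i ∙ y ≡ b i)
trivialKernel⇒solvable {n} M triv b
  with nonzeroKernelVector (ℕ.n<1+n n) (λ i → (- b i) ∷ M i)
... | x , (j , xⱼ≢0) , aug≡0 = (λ s → 1/ t * tail x s) , solves
  where
  t = x zero

  t≢0 : t ≢ 0ℚ
  t≢0 t≡0 = xⱼ≢0 (x≡0 j)
    where
    tail≡0 : ∀ s → tail x s ≡ 0ℚ
    tail≡0 = triv (tail x) (λ i → begin
      M i ∙ tail x                ≡⟨ solve 2 (λ b r → r := (:- b) :* con 0ℚ :+ r) refl (b i) (M i ∙ tail x) ⟩
      (- b i) * 0ℚ + M i ∙ tail x ≡⟨ cong (λ z → (- b i) * z + M i ∙ tail x) t≡0 ⟨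
      (- b i) * t + M i ∙ tail x  ≡⟨ aug≡0 i ⟩
      0ℚ                          ∎)
    x≡0 : ∀ j → x j ≡ 0ℚ
    x≡0 zero    = t≡0
    x≡0 (suc s) = tail≡0 s

  instance
    t-nonZero : NonZero t
    t-nonZero = ≢-nonZero t≢0

  solves : ∀ i → M i ∙ (λ s → 1/ t * tail x s) ≡ b i
  solves i = begin
    M i ∙ (λ s → 1/ t * tail x s)
      ≡⟨ ∙-scaleʳ (M i) (1/ t) (tail x) ⟩
    1/ t * (M i ∙ tail x)
      ≡⟨ solve 4 (λ b t u r → u :* r := u :* ((:- b) :* t :+ r) :+ u :* t :* b) refl (b i) t (1/ t) (M i ∙ tail x) ⟩
    1/ t * ((- b i) * t + M i ∙ tail x) + 1/ t * t * b i
      ≡⟨ cong₂ (λ z w → 1/ t * z + w * b i) (aug≡0 i) (ℚ.*-inverseˡ t) ⟩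
    1/ t * 0ℚ + 1ℚ * b i
      ≡⟨ solve 2 (λ u b → u :* con 0ℚ :+ con 1ℚ :* b := b) refl (1/ t) (b i) ⟩
    b i ∎

-- Column `j` of the inverse solves `M y = e_j`, which gives a right inverse; triviality of the
-- kernel is used again to make it two-sided.
trivialKernel⇒nonsingular : ∀ {n} (M : Matrix n n) → TrivialKernel M → Nonsingular M
trivialKernel⇒nonsingular {n} M triv = P , MP≡1 , PM≡1
  where
  P : Matrix n n
  P t j = proj₁ (trivialKernel⇒solvable M triv (λ i → identity n i j)) t

  MP≡1 : ∀ i j → (M ·ₘ P) i j ≡ identity n i j
  MP≡1 i j = proj₂ (trivialKernel⇒solvable M triv (λ i → identity n i j)) i

  -- M (P M - 1) = (M P) M - M = 0.
  PM≡1 : ∀ i j → (P ·ₘ M) i j ≡ identity n i j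
  PM≡1 i j = begin
    (P ·ₘ M) i j
      ≡⟨ solve 2 (λ p e → p := (p :- e) :+ e) refl ((P ·ₘ M) i j) (identity n i j) ⟩
    z i + identity n i j
      ≡⟨ cong (_+ identity n i j) (triv z Mz≡0 i) ⟩
    0ℚ + identity n i j
      ≡⟨ ℚ.+-identityˡ (identity n i j) ⟩
    identity n i j ∎
    where
    column : Vector ℚ n
    column t = M t j
    z : Vector ℚ n
    z t = (P ·ₘ M) t j - identity n t j
    Mz≡0 : InKernel M z
    Mz≡0 s = begin
      M s ∙ z
        ≡⟨ ∙-distribˡ-- (M s) (λ t → P t ∙ column) (λ t → identity n t j) ⟩
      M s ∙ (λ t → P t ∙ column) - M s ∙ (λ t → identity n t j)
        ≡⟨ cong₂ _-_ (trans (∙-assoc (M s) P column)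
             (trans (∙-congˡ column (MP≡1 s)) (∙-identityˡ s column))) (∙-identityʳ (M s) j) ⟩
      M s j - M s j
        ≡⟨ ℚ.+-inverseʳ (M s j) ⟩
      0ℚ ∎

-- Rows of the band matrix in terms of prefix sums.

χ : ℕ → ℕ → ℚ
χ a c = if a <ᵇ c then 1ℚ else 0ℚ

<ᵇ-suc : ∀ m n → (m <ᵇ suc n) ≡ not (n <ᵇ m)
<ᵇ-suc zero    n       = refl
<ᵇ-suc (suc m) zero    = refl
<ᵇ-suc (suc m) (suc n) = <ᵇ-suc m n

-- Truncation is harmless: for `i < k` both indicators are 0. This lets `X (m ∸ k)` stand for the
-- prefix sum at `m - k`, read as 0 at negative arguments.
χ-∸ : ∀ k j i → χ (k ℕ.+ j) i ≡ χ j (i ∸ k)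
χ-∸ zero    j i       = refl
χ-∸ (suc k) j zero    = refl
χ-∸ (suc k) j (suc i) = χ-∸ k j i

bandEntry : ℕ → ℕ → ℕ → ℚ
bandEntry k i j = if onSuperdiagonal k i j then 1ℚ else if onSuperdiagonal k j i then - 1ℚ else 0ℚ

-- The band `i < j ≤ i + k` is `χ j (suc (i + k)) - χ j (suc i)`, and the band `j < i ≤ k + j` is
-- `χ j i - χ (k + j) i`, entering with a minus sign. Both sides are unchanged when `i` and `j` grow
-- together, so the induction ends in row zero or column zero.
bandEntry-χ : ∀ k i j → bandEntry k i j ≡ (χ j (suc (i ℕ.+ k)) + χ (k ℕ.+ j) i) - (χ j (suc i) + χ j i)
bandEntry-χ k zero zero = refl
bandEntry-χ k zero (suc j) with j <ᵇ k
... | true  = refl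
... | false = refl
bandEntry-χ k (suc i) zero rewrite ℕ.+-identityʳ k | <ᵇ-suc k i with i <ᵇ k
... | true  = refl
... | false = refl
bandEntry-χ k (suc i) (suc j) rewrite ℕ.+-suc k j = bandEntry-χ k i j

-- Written as a dot product with an indicator, so that `bandEntry-χ` turns each row of `A` into four
-- of its values. It is total in `c`, which absorbs the indices past the end of the vector.
prefixSum : ∀ {n} → Vector ℚ n → ℕ → ℚ
prefixSum x c = (λ j → χ (toℕ j) c) ∙ x

prefixSum-0 : ∀ {n} (x : Vector ℚ n) → prefixSum x 0 ≡ 0ℚ
prefixSum-0 x = ∙-zeroˡ x

prefixSum-beyond : ∀ {n} (x : Vector ℚ n) {c} → n ≤ c → prefixSum x c ≡ prefixSum x n
prefixSum-beyond {zero}  x _           = refl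
prefixSum-beyond {suc n} x (s≤s n≤c) = cong (1ℚ * x zero +_) (prefixSum-beyond (tail x) n≤c)

prefixSum-step : ∀ {n} (x : Vector ℚ n) j → prefixSum x (suc (toℕ j)) - prefixSum x (toℕ j) ≡ x j
prefixSum-step x zero = begin
  (1ℚ * x zero + prefixSum (tail x) 0) - prefixSum x 0
    ≡⟨ cong₂ (λ s t → (1ℚ * x zero + s) - t) (prefixSum-0 (tail x)) (prefixSum-0 x) ⟩
  (1ℚ * x zero + 0ℚ) - 0ℚ
    ≡⟨ solve 1 (λ x → (con 1ℚ :* x :+ con 0ℚ) :- con 0ℚ := x) refl (x zero) ⟩
  x zero ∎
prefixSum-step x (suc j) = begin
  (x₀ + s) - (x₀ + t) ≡⟨ solve 3 (λ x s t → (x :+ s) :- (x :+ t) := s :- t) refl x₀ s t ⟩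
  s - t               ≡⟨ prefixSum-step (tail x) j ⟩
  x (suc j)           ∎
  where
  x₀ = 1ℚ * x zero
  s = prefixSum (tail x) (suc (toℕ j))
  t = prefixSum (tail x) (toℕ j)

differences : ∀ n → (ℕ → ℚ) → Vector ℚ n
differences n G j = G (suc (toℕ j)) - G (toℕ j)

prefixSum-differences : ∀ {n} G {c} → c ≤ n → prefixSum (differences n G) c ≡ G c - G 0
prefixSum-differences {n} G {zero} _ = trans (prefixSum-0 (differences n G)) (sym (ℚ.+-inverseʳ (G 0)))
prefixSum-differences {suc n} G {suc c} (s≤s c≤n) = begin
  1ℚ * (G 1 - G 0) + prefixSum (differences n (λ m → G (suc m))) c
    ≡⟨ cong (1ℚ * (G 1 - G 0) +_) (prefixSum-differences (λ m → G (suc m)) c≤n) ⟩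
  1ℚ * (G 1 - G 0) + (G (suc c) - G 1)
    ≡⟨ solve 3 (λ a b c → con 1ℚ :* (a :- b) :+ (c :- a) := c :- b) refl (G 1) (G 0) (G (suc c)) ⟩
  G (suc c) - G 0 ∎

A-row : ∀ {n} k (x : Vector ℚ n) i → let X = prefixSum x; m = toℕ i in
        (A n k ·ᵥ x) i ≡ (X (suc (m ℕ.+ k)) + X (m ∸ k)) - (X (suc m) + X m)
A-row k x i = begin
  A _ k i ∙ x
    ≡⟨ ∙-congˡ x (λ j → trans (bandEntry-χ k m (toℕ j))
         (cong (λ z → (χ (toℕ j) (suc (m ℕ.+ k)) + z) - (χ (toℕ j) (suc m) + χ (toℕ j) m)) (χ-∸ k (toℕ j) m))) ⟩
  (λ j → (δ (suc (m ℕ.+ k)) j + δ (m ∸ k) j) - (δ (suc m) j + δ m j)) ∙ x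
    ≡⟨ ∙-distribʳ-- x (λ j → δ (suc (m ℕ.+ k)) j + δ (m ∸ k) j) (λ j → δ (suc m) j + δ m j) ⟩
  (λ j → δ (suc (m ℕ.+ k)) j + δ (m ∸ k) j) ∙ x - (λ j → δ (suc m) j + δ m j) ∙ x
    ≡⟨ cong₂ _-_ (∙-distribʳ-+ x (δ (suc (m ℕ.+ k))) (δ (m ∸ k))) (∙-distribʳ-+ x (δ (suc m)) (δ m)) ⟩
  (prefixSum x (suc (m ℕ.+ k)) + prefixSum x (m ∸ k)) - (prefixSum x (suc m) + prefixSum x m) ∎
  where
  m = toℕ i
  δ : ℕ → Vector ℚ _
  δ c j = χ (toℕ j) c

-- The kernel equations in three blocks of k rows.

data Third (k : ℕ) : ℕ → Set where
  first  : ∀ {i} → i < k → Third k i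
  second : ∀ {i} → i < k → Third k (k ℕ.+ i)
  third  : ∀ {i} → i < k → Third k (k ℕ.+ k ℕ.+ i)

third? : ∀ k {m} → m < 3 ℕ.* k → Third k m
third? k {m} m<3k with m ℕ.<? k
... | yes m<k = first m<k
... | no  m≮k with ℕ.m≤n⇒∃[o]m+o≡n (ℕ.≮⇒≥ m≮k)
...   | i , refl with i ℕ.<? k
...     | yes i<k = second i<k
...     | no  i≮k with ℕ.m≤n⇒∃[o]m+o≡n (ℕ.≮⇒≥ i≮k)
...       | j , refl = subst (Third k) (ℕ.+-assoc k k j)
                         (third (subst (j <_) (ℕ.+-identityʳ k) (ℕ.+-cancelˡ-< k _ _ (ℕ.+-cancelˡ-< k _ _ m<3k))))

-- The equations expressing A x = 0 in the prefix sums X of x, one field per block of k rows.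
record Balanced (k : ℕ) (X : ℕ → ℚ) : Set where
  field
    bal₁ : ∀ {i} → i < k → X (k ℕ.+ suc i) ≡ X (suc i) + X i
    bal₂ : ∀ {i} → i < k → X (k ℕ.+ k ℕ.+ suc i) + X i ≡ X (k ℕ.+ suc i) + X (k ℕ.+ i)
    bal₃ : ∀ {i} → i < k → X (k ℕ.+ k ℕ.+ k) + X (k ℕ.+ i) ≡ X (k ℕ.+ k ℕ.+ suc i) + X (k ℕ.+ k ℕ.+ i)

3*k≡k+k+k : ∀ k → 3 ℕ.* k ≡ k ℕ.+ k ℕ.+ k
3*k≡k+k+k k = begin
  k ℕ.+ (k ℕ.+ (k ℕ.+ 0)) ≡⟨ cong (λ z → k ℕ.+ (k ℕ.+ z)) (ℕ.+-identityʳ k) ⟩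
  k ℕ.+ (k ℕ.+ k)         ≡⟨ ℕ.+-assoc k k k ⟨
  k ℕ.+ k ℕ.+ k           ∎

module _ {k : ℕ} (x : Vector ℚ (3 ℕ.* k)) where

  private
    X : ℕ → ℚ
    X = prefixSum x

    lhs : ℕ → ℚ
    lhs m = X (suc (m ℕ.+ k)) + X (m ∸ k)

    lhs₁ : ∀ {i} → i < k → lhs i ≡ X (k ℕ.+ suc i)
    lhs₁ {i} i<k = begin
      -- In the first block `i ∸ k` truncates to 0, and `X 0` vanishes.
      X (suc (i ℕ.+ k)) + X (i ∸ k) ≡⟨ cong₂ (λ a b → X a + X b) (ℕ.+-comm (suc i) k) (ℕ.m≤n⇒m∸n≡0 (ℕ.<⇒≤ i<k)) ⟩
      X (k ℕ.+ suc i) + X 0         ≡⟨ cong (X (k ℕ.+ suc i) +_) (prefixSum-0 x) ⟩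
      X (k ℕ.+ suc i) + 0ℚ          ≡⟨ ℚ.+-identityʳ _ ⟩
      X (k ℕ.+ suc i)               ∎

    lhs₂ : ∀ i → lhs (k ℕ.+ i) ≡ X (k ℕ.+ k ℕ.+ suc i) + X i
    lhs₂ i = cong₂ (λ a b → X a + X b) index (ℕ.m+n∸m≡n k i)
      where
      index : suc (k ℕ.+ i ℕ.+ k) ≡ k ℕ.+ k ℕ.+ suc i
      index = begin
        suc (k ℕ.+ i) ℕ.+ k     ≡⟨ ℕ.+-comm (suc (k ℕ.+ i)) k ⟩
        k ℕ.+ suc (k ℕ.+ i)     ≡⟨ cong (k ℕ.+_) (ℕ.+-suc k i) ⟨
        k ℕ.+ (k ℕ.+ suc i)     ≡⟨ ℕ.+-assoc k k (suc i) ⟨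
        k ℕ.+ k ℕ.+ suc i       ∎

    lhs₃ : ∀ i → lhs (k ℕ.+ k ℕ.+ i) ≡ X (k ℕ.+ k ℕ.+ k) + X (k ℕ.+ i)
    lhs₃ i = cong₂ _+_
      -- In the last block the upper index is past the end, so the prefix sum there is the total
      -- X(3k).
      (trans (prefixSum-beyond x beyond) (cong X (3*k≡k+k+k k)))
      (cong X (trans (cong (_∸ k) (ℕ.+-assoc k k i)) (ℕ.m+n∸m≡n k (k ℕ.+ i))))
      where
      beyond : 3 ℕ.* k ≤ suc (k ℕ.+ k ℕ.+ i ℕ.+ k)
      beyond = subst (_≤ suc (k ℕ.+ k ℕ.+ i ℕ.+ k)) (sym (3*k≡k+k+k k))
        (ℕ.m≤n⇒m≤1+n (ℕ.+-monoˡ-≤ k (ℕ.m≤m+n (k ℕ.+ k) i)))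

  inKernel⇒balanced : InKernel (A (3 ℕ.* k) k) x → Balanced k X
  inKernel⇒balanced Ax≡0 = record
    { bal₁ = λ {i} i<k → trans (sym (lhs₁ i<k)) (row (ℕ.≤-trans i<k (ℕ.m≤m+n k _)))
    ; bal₂ = λ {i} i<k → trans (sym (lhs₂ i)) (trans (row (ℕ.+-monoʳ-< k (ℕ.≤-trans i<k (ℕ.m≤m+n k _))))
               (cong (λ a → X a + X (k ℕ.+ i)) (sym (ℕ.+-suc k i))))
    ; bal₃ = λ {i} i<k → trans (sym (lhs₃ i)) (trans (row (subst (k ℕ.+ k ℕ.+ i <_) (sym (3*k≡k+k+k k)) (ℕ.+-monoʳ-< (k ℕ.+ k) i<k)))
               (cong (λ a → X a + X (k ℕ.+ k ℕ.+ i)) (sym (ℕ.+-suc (k ℕ.+ k) i))))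
    }
    where
    row : ∀ {m} → m < 3 ℕ.* k → lhs m ≡ X (suc m) + X m
    row {m} m<3k = subst (λ m → lhs m ≡ X (suc m) + X m) (toℕ-fromℕ< m<3k)
      (x∙y⁻¹≈ε⇒x≈y _ _ (trans (sym (A-row k x (fromℕ< m<3k))) (Ax≡0 (fromℕ< m<3k))))

  balanced⇒inKernel : Balanced k X → InKernel (A (3 ℕ.* k) k) x
  balanced⇒inKernel balanced r = trans (A-row k x r) (x≈y⇒x∙y⁻¹≈ε (row (third? k (toℕ<n r))))
    where
    open Balanced balanced
    row : ∀ {m} → Third k m → lhs m ≡ X (suc m) + X m
    row (first i<k)      = trans (lhs₁ i<k) (bal₁ i<k)
    row (second {i} i<k) = trans (lhs₂ i) (trans (bal₂ i<k) (cong (λ a → X a + X (k ℕ.+ i)) (ℕ.+-suc k i)))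
    row (third {i} i<k)  = trans (lhs₃ i) (trans (bal₃ i<k) (cong (λ a → X a + X (k ℕ.+ k ℕ.+ i)) (ℕ.+-suc (k ℕ.+ k) i)))

-- Periods of functions on ℕ and their gcd.

Period : (ℕ → ℚ) → ℕ → Set
Period f p = ∀ n → f (p ℕ.+ n) ≡ f n

period-* : ∀ {f p} m → Period f p → Period f (m ℕ.* p)
period-*         zero    per n = refl
period-* {f} {p} (suc m) per n = trans (cong f (ℕ.+-assoc p (m ℕ.* p) n)) (trans (per _) (period-* m per n))

period-∣ : ∀ {f d m} → d ∣ m → Period f d → Period f m
period-∣ (divides q refl) per = period-* q per

-- A difference of periods is a period: step forward by `b` first, then the total shift `b + d` is
-- the period `a`.
period-cancel : ∀ {f a b d} → d ℕ.+ b ≡ a → Period f a → Period f b → Period f d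
period-cancel {f} {a} {b} {d} refl perₐ per_b n = begin
  f (d ℕ.+ n)         ≡⟨ per_b (d ℕ.+ n) ⟨
  f (b ℕ.+ (d ℕ.+ n)) ≡⟨ cong f (ℕ.+-assoc b d n) ⟨
  f (b ℕ.+ d ℕ.+ n)   ≡⟨ cong (λ z → f (z ℕ.+ n)) (ℕ.+-comm b d) ⟩
  f (d ℕ.+ b ℕ.+ n)   ≡⟨ perₐ n ⟩
  f n                 ∎

-- Bézout writes the gcd as a difference of multiples of `m` and `n`, in one order or the other, and
-- periods are closed under multiples and differences.
period-gcd : ∀ {f m n d} → GCD m n d → Period f m → Period f n → Period f d
period-gcd g perₘ perₙ with Bézout.identity g
... | Bézout.+- x y eq = period-cancel eq (period-* x perₘ) (period-* y perₙ)
... | Bézout.-+ x y eq = period-cancel eq (period-* y perₙ) (period-* x perₘ)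

period-% : ∀ {f p} → Period f (suc p) → ∀ n → f n ≡ f (n % suc p)
period-% {f} {p} per n = begin
  f n                                        ≡⟨ cong f (m≡m%n+[m/n]*n n (suc p)) ⟩
  f (n % suc p ℕ.+ n / suc p ℕ.* suc p)      ≡⟨ cong f (ℕ.+-comm (n % suc p) _) ⟩
  f (n / suc p ℕ.* suc p ℕ.+ n % suc p)      ≡⟨ period-* (n / suc p) per (n % suc p) ⟩
  f (n % suc p)                              ∎

-- Balanced prefix sums and functions of periods k+1 and 4.

-- For P of period k+1, X is on [0, k], [k, 2k] and [2k, 3k] a sum of one, two and three
-- cyclically consecutive values of P.
record Follows (k : ℕ) (P X : ℕ → ℚ) : Set where
  field
    fol₁ : ∀ {i} → i ≤ k → X i ≡ P i
    fol₂ : ∀ {i} → i ≤ k → X (k ℕ.+ i) ≡ P (k ℕ.+ i) + P i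
    fol₃ : ∀ {i} → i ≤ k → X (k ℕ.+ k ℕ.+ i) ≡ P (k ℕ.+ k ℕ.+ i) + P (k ℕ.+ i) + P i

module _ {k : ℕ} {P X Y : ℕ → ℚ} (folX : Follows k P X) (folY : Follows k P Y) where
  private
    module X = Follows folX
    module Y = Follows folY

  -- Stated for consecutive differences because these are the entries of the vector. The closed
  -- bounds `i ≤ k` in `Follows` put `m` and `suc m` in a common block.
  follows-unique : ∀ {m} → m < 3 ℕ.* k → X (suc m) - X m ≡ Y (suc m) - Y m
  follows-unique m<3k with third? k m<3k
  ... | first i<k = cong₂ _-_ (trans (X.fol₁ i<k) (sym (Y.fol₁ i<k)))
                              (trans (X.fol₁ (ℕ.<⇒≤ i<k)) (sym (Y.fol₁ (ℕ.<⇒≤ i<k))))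
  ... | second {i} i<k rewrite sym (ℕ.+-suc k i) =
    cong₂ _-_ (trans (X.fol₂ i<k) (sym (Y.fol₂ i<k)))
              (trans (X.fol₂ (ℕ.<⇒≤ i<k)) (sym (Y.fol₂ (ℕ.<⇒≤ i<k))))
  ... | third {i} i<k rewrite sym (ℕ.+-suc (k ℕ.+ k) i) =
    cong₂ _-_ (trans (X.fol₃ i<k) (sym (Y.fol₃ i<k)))
              (trans (X.fol₃ (ℕ.<⇒≤ i<k)) (sym (Y.fol₃ (ℕ.<⇒≤ i<k))))

module Cyclic {k : ℕ} {P : ℕ → ℚ} (P0≡0 : P 0 ≡ 0ℚ) (per : Period P (suc k)) where

  shift₁ : ∀ i → P (k ℕ.+ suc i) ≡ P i
  shift₁ i = trans (cong P (ℕ.+-suc k i)) (per i)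

  shift₂ : ∀ i → P (k ℕ.+ k ℕ.+ suc i) ≡ P (k ℕ.+ i)
  shift₂ i = begin
    P (k ℕ.+ k ℕ.+ suc i)   ≡⟨ cong P (ℕ.+-suc (k ℕ.+ k) i) ⟩
    P (suc (k ℕ.+ k ℕ.+ i)) ≡⟨ cong (λ z → P (suc z)) (ℕ.+-assoc k k i) ⟩
    P (suc k ℕ.+ (k ℕ.+ i)) ≡⟨ per (k ℕ.+ i) ⟩
    P (k ℕ.+ i)             ∎

  P[1+k]≡0 : P (suc k) ≡ 0ℚ
  P[1+k]≡0 = trans (cong P (sym (ℕ.+-identityʳ (suc k)))) (trans (per 0) P0≡0)

  -- Up to multiples of the period, this is P (n) + P (n+1) + P (n+2) + P (n+3) for n = 2k + i.
  window : ℕ → ℚ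
  window i = P (k ℕ.+ k ℕ.+ i) + P (k ℕ.+ i) + P i + P (suc i)

  -- Sliding the window drops its first value and gains the next one. Modulo k+1 the gained position
  -- `2 + i` is 2k + i + 4, four places after the dropped one, so constancy of `window` amounts to
  -- period 4.
  window-suc : ∀ i → window (suc i) ≡ window i + (P (2 ℕ.+ i) - P (k ℕ.+ k ℕ.+ i))
  window-suc i = begin
    P (k ℕ.+ k ℕ.+ suc i) + P (k ℕ.+ suc i) + P (suc i) + P (2 ℕ.+ i)
      ≡⟨ cong₂ (λ a b → a + b + P (suc i) + P (2 ℕ.+ i)) (shift₂ i) (shift₁ i) ⟩
    P (k ℕ.+ i) + P i + P (suc i) + P (2 ℕ.+ i)
      ≡⟨ solve 5 (λ a b c d e → b :+ c :+ d :+ e := (a :+ b :+ c :+ d) :+ (e :- a)) refl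
           (P (k ℕ.+ k ℕ.+ i)) (P (k ℕ.+ i)) (P i) (P (suc i)) (P (2 ℕ.+ i)) ⟩
    window i + (P (2 ℕ.+ i) - P (k ℕ.+ k ℕ.+ i)) ∎

  -- The fourth summand is `P (suc k)`, which is 0; what remains is the value `Follows` gives to
  -- X(3k).
  window-k : window k ≡ P (k ℕ.+ k ℕ.+ k) + P (k ℕ.+ k) + P k
  window-k = trans (cong (P (k ℕ.+ k ℕ.+ k) + P (k ℕ.+ k) + P k +_) P[1+k]≡0) (ℚ.+-identityʳ _)

  window-period : Period window (suc k)
  window-period i = cong₂ _+_ (cong₂ _+_ (cong₂ _+_ (at (k ℕ.+ k)) (at k)) (per i))
                              (trans (cong P (sym (ℕ.+-suc (suc k) i))) (per (suc i)))
    where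
    at : ∀ a → P (a ℕ.+ (suc k ℕ.+ i)) ≡ P (a ℕ.+ i)
    at a = begin
      P (a ℕ.+ (suc k ℕ.+ i)) ≡⟨ cong P (ℕ.+-assoc a (suc k) i) ⟨
      P (a ℕ.+ suc k ℕ.+ i)   ≡⟨ cong (λ z → P (z ℕ.+ i)) (ℕ.+-comm a (suc k)) ⟩
      P (suc k ℕ.+ a ℕ.+ i)   ≡⟨ cong P (ℕ.+-assoc (suc k) a i) ⟩
      P (suc k ℕ.+ (a ℕ.+ i)) ≡⟨ per (a ℕ.+ i) ⟩
      P (a ℕ.+ i)             ∎

  shift₂₂ : ∀ i → P (k ℕ.+ k ℕ.+ (2 ℕ.+ i)) ≡ P i
  shift₂₂ i = trans (shift₂ (suc i)) (shift₁ i)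

  -- Under `Follows` the bracket on the left is X(k+i) and those on the right are X(2k+i+1), via
  -- `shift₃`, and X(2k+i). Hence `bal₃` at `i` says that `window i` equals X(3k).
  window-split : ∀ i → window i + (P (k ℕ.+ i) + P i) ≡
                 (P (k ℕ.+ i) + P i + P (suc i)) + (P (k ℕ.+ k ℕ.+ i) + P (k ℕ.+ i) + P i)
  window-split i = solve 4 (λ a b c d → (a :+ b :+ c :+ d) :+ (b :+ c) := (b :+ c :+ d) :+ (a :+ b :+ c)) refl
    (P (k ℕ.+ k ℕ.+ i)) (P (k ℕ.+ i)) (P i) (P (suc i))

  shift₃ : ∀ i → P (k ℕ.+ k ℕ.+ suc i) + P (k ℕ.+ suc i) + P (suc i) ≡ P (k ℕ.+ i) + P i + P (suc i)
  shift₃ i = cong₂ (λ a b → a + b + P (suc i)) (shift₂ i) (shift₁ i)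

  period4⇒window-const : Period P 4 → ∀ i → window i ≡ window 0
  period4⇒window-const per4 zero    = refl
  period4⇒window-const per4 (suc i) = begin
    window (suc i)                               ≡⟨ window-suc i ⟩
    window i + (P (2 ℕ.+ i) - P (k ℕ.+ k ℕ.+ i)) ≡⟨ cong (window i +_) (x≈y⇒x∙y⁻¹≈ε P[2+i]≡P[2k+i]) ⟩
    window i + 0ℚ                                ≡⟨ ℚ.+-identityʳ (window i) ⟩
    window i                                     ≡⟨ period4⇒window-const per4 i ⟩
    window 0                                     ∎
    where
    P[2+i]≡P[2k+i] : P (2 ℕ.+ i) ≡ P (k ℕ.+ k ℕ.+ i)
    P[2+i]≡P[2k+i] = begin
      P (2 ℕ.+ i)                       ≡⟨ shift₂₂ (2 ℕ.+ i) ⟨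
      P (k ℕ.+ k ℕ.+ (4 ℕ.+ i))         ≡⟨ cong P (ℕ.+-assoc (k ℕ.+ k) 4 i) ⟨
      P (k ℕ.+ k ℕ.+ 4 ℕ.+ i)           ≡⟨ cong (λ z → P (z ℕ.+ i)) (ℕ.+-comm (k ℕ.+ k) 4) ⟩
      P (4 ℕ.+ (k ℕ.+ k ℕ.+ i))         ≡⟨ per4 (k ℕ.+ k ℕ.+ i) ⟩
      P (k ℕ.+ k ℕ.+ i)                 ∎

  window-const⇒period4 : ∀ {T} → (∀ i → window i ≡ T) → Period P 4
  window-const⇒period4 {T} const n = begin
    P (2 ℕ.+ (2 ℕ.+ n))         ≡⟨ x∙y⁻¹≈ε⇒x≈y _ _ difference≡0 ⟩
    P (k ℕ.+ k ℕ.+ (2 ℕ.+ n))   ≡⟨ shift₂₂ n ⟩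
    P n                         ∎
    where
    difference : ℚ
    -- Sliding from position `2 + n` is the right choice: the dropped value is P(2k+2+n), which
    -- `shift₂₂` reduces to `P n`.
    difference = P (2 ℕ.+ (2 ℕ.+ n)) - P (k ℕ.+ k ℕ.+ (2 ℕ.+ n))
    difference≡0 : difference ≡ 0ℚ
    difference≡0 = ∙-cancelˡ T difference 0ℚ (begin
      T + difference                 ≡⟨ cong (_+ difference) (const (2 ℕ.+ n)) ⟨
      window (2 ℕ.+ n) + difference  ≡⟨ window-suc (2 ℕ.+ n) ⟨
      window (3 ℕ.+ n)               ≡⟨ const (3 ℕ.+ n) ⟩
      T                              ≡⟨ ℚ.+-identityʳ T ⟨
      T + 0ℚ                         ∎)

  module _ {X : ℕ → ℚ} (fol : Follows k P X) where
    open Follows fol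

    private
      X₃ : ∀ {i} → i < k → X (k ℕ.+ k ℕ.+ suc i) ≡ P (k ℕ.+ i) + P i + P (suc i)
      X₃ {i} i<k = trans (fol₃ i<k) (shift₃ i)

      X[3k]≡window : X (k ℕ.+ k ℕ.+ k) ≡ window k
      X[3k]≡window = trans (fol₃ ℕ.≤-refl) (sym window-k)

    -- The rows of the last block fix `window i` for `i < k`, `window-k` fixes it at `k`, and period
    -- k+1 then covers every `i`.
    balanced⇒period4 : Balanced k X → Period P 4
    balanced⇒period4 balanced = window-const⇒period4 (λ i → begin
      window i             ≡⟨ period-% window-period i ⟩
      window (i % suc k)   ≡⟨ window≡T (ℕ.s≤s⁻¹ (m%n<n i (suc k))) ⟩
      X (k ℕ.+ k ℕ.+ k)    ∎)
      where
      open Balanced balanced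
      window≡T : ∀ {i} → i ≤ k → window i ≡ X (k ℕ.+ k ℕ.+ k)
      window≡T {i} i≤k with ℕ.m≤n⇒m<n∨m≡n i≤k
      ... | inj₂ refl = sym X[3k]≡window
      ... | inj₁ i<k  = ∙-cancelʳ (P (k ℕ.+ i) + P i) _ _ (begin
        window i + (P (k ℕ.+ i) + P i)
          ≡⟨ window-split i ⟩
        (P (k ℕ.+ i) + P i + P (suc i)) + (P (k ℕ.+ k ℕ.+ i) + P (k ℕ.+ i) + P i)
          ≡⟨ cong₂ _+_ (X₃ i<k) (fol₃ i≤k) ⟨
        X (k ℕ.+ k ℕ.+ suc i) + X (k ℕ.+ k ℕ.+ i)
          ≡⟨ bal₃ i<k ⟨
        X (k ℕ.+ k ℕ.+ k) + X (k ℕ.+ i)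
          ≡⟨ cong (X (k ℕ.+ k ℕ.+ k) +_) (fol₂ i≤k) ⟩
        X (k ℕ.+ k ℕ.+ k) + (P (k ℕ.+ i) + P i) ∎)

    -- The first two blocks follow from period k+1 by regrouping; period 4 enters in `bal₃`, through
    -- constancy of `window`.
    period4⇒balanced : Period P 4 → Balanced k X
    period4⇒balanced per4 = record
      { bal₁ = λ {i} i<k → begin
          X (k ℕ.+ suc i)           ≡⟨ fol₂ i<k ⟩
          P (k ℕ.+ suc i) + P (suc i) ≡⟨ cong (_+ P (suc i)) (shift₁ i) ⟩
          P i + P (suc i)           ≡⟨ ℚ.+-comm (P i) (P (suc i)) ⟩
          P (suc i) + P i           ≡⟨ cong₂ _+_ (fol₁ i<k) (fol₁ (ℕ.<⇒≤ i<k)) ⟨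
          X (suc i) + X i           ∎
      ; bal₂ = λ {i} i<k → begin
          X (k ℕ.+ k ℕ.+ suc i) + X i
            ≡⟨ cong₂ _+_ (X₃ i<k) (fol₁ (ℕ.<⇒≤ i<k)) ⟩
          P (k ℕ.+ i) + P i + P (suc i) + P i
            ≡⟨ solve 3 (λ a b c → a :+ b :+ c :+ b := (b :+ c) :+ (a :+ b)) refl (P (k ℕ.+ i)) (P i) (P (suc i)) ⟩
          (P i + P (suc i)) + (P (k ℕ.+ i) + P i)
            ≡⟨ cong₂ _+_ (trans (fol₂ i<k) (cong (_+ P (suc i)) (shift₁ i))) (fol₂ (ℕ.<⇒≤ i<k)) ⟨
          X (k ℕ.+ suc i) + X (k ℕ.+ i) ∎
      ; bal₃ = λ {i} i<k → begin
          X (k ℕ.+ k ℕ.+ k) + X (k ℕ.+ i)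
            ≡⟨ cong₂ _+_ (trans X[3k]≡window (trans (const k) (sym (const i)))) (fol₂ (ℕ.<⇒≤ i<k)) ⟩
          window i + (P (k ℕ.+ i) + P i)
            ≡⟨ window-split i ⟩
          (P (k ℕ.+ i) + P i + P (suc i)) + (P (k ℕ.+ k ℕ.+ i) + P (k ℕ.+ i) + P i)
            ≡⟨ cong₂ _+_ (X₃ i<k) (fol₃ (ℕ.<⇒≤ i<k)) ⟨
          X (k ℕ.+ k ℕ.+ suc i) + X (k ℕ.+ k ℕ.+ i) ∎
      }
      where
      const : ∀ i → window i ≡ window 0
      const = period4⇒window-const per4

module FromBalanced {k : ℕ} {X : ℕ → ℚ} (X0≡0 : X 0 ≡ 0ℚ) (balanced : Balanced k X) where
  open Balanced balanced

  P : ℕ → ℚ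
  P n = X (n % suc k)

  P-period : Period P (suc k)
  P-period n = cong X (trans (cong (_% suc k) (ℕ.+-comm (suc k) n)) ([m+n]%n≡m%n n (suc k)))

  open Cyclic X0≡0 P-period

  follows : Follows k P X
  follows = record { fol₁ = fol₁ ; fol₂ = fol₂ ; fol₃ = fol₃ }
    where
    fol₁ : ∀ {i} → i ≤ k → X i ≡ P i
    fol₁ i≤k = cong X (sym (m≤n⇒m%n≡m i≤k))

    fol₂ : ∀ {i} → i ≤ k → X (k ℕ.+ i) ≡ P (k ℕ.+ i) + P i
    -- At a block boundary the formula has one more summand than that of the previous block; it is
    -- `P 0`, which vanishes.
    fol₂ {zero} _ = begin
      X (k ℕ.+ 0)           ≡⟨ fol₁ (ℕ.≤-reflexive (ℕ.+-identityʳ k)) ⟩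
      P (k ℕ.+ 0)           ≡⟨ ℚ.+-identityʳ _ ⟨
      P (k ℕ.+ 0) + 0ℚ      ≡⟨ cong (P (k ℕ.+ 0) +_) X0≡0 ⟨
      P (k ℕ.+ 0) + P 0     ∎
    fol₂ {suc i} i<k = begin
      X (k ℕ.+ suc i)               ≡⟨ bal₁ i<k ⟩
      X (suc i) + X i               ≡⟨ ℚ.+-comm (X (suc i)) (X i) ⟩
      X i + X (suc i)               ≡⟨ cong₂ _+_ (fol₁ (ℕ.<⇒≤ i<k)) (fol₁ i<k) ⟩
      P i + P (suc i)               ≡⟨ cong (_+ P (suc i)) (shift₁ i) ⟨
      P (k ℕ.+ suc i) + P (suc i)   ∎

    fol₃ : ∀ {i} → i ≤ k → X (k ℕ.+ k ℕ.+ i) ≡ P (k ℕ.+ k ℕ.+ i) + P (k ℕ.+ i) + P i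
    fol₃ {zero} _ = begin
      X (k ℕ.+ k ℕ.+ 0)                         ≡⟨ cong X (ℕ.+-identityʳ (k ℕ.+ k)) ⟩
      X (k ℕ.+ k)                               ≡⟨ fol₂ ℕ.≤-refl ⟩
      P (k ℕ.+ k) + P k                         ≡⟨ cong₂ (λ a b → P a + P b) (ℕ.+-identityʳ (k ℕ.+ k)) (ℕ.+-identityʳ k) ⟨
      P (k ℕ.+ k ℕ.+ 0) + P (k ℕ.+ 0)           ≡⟨ ℚ.+-identityʳ _ ⟨
      P (k ℕ.+ k ℕ.+ 0) + P (k ℕ.+ 0) + 0ℚ      ≡⟨ cong (P (k ℕ.+ k ℕ.+ 0) + P (k ℕ.+ 0) +_) X0≡0 ⟨
      P (k ℕ.+ k ℕ.+ 0) + P (k ℕ.+ 0) + P 0     ∎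
    -- `bal₂` has the extra term `X i` on its left, so `P i` is added to both sides and cancelled.
    fol₃ {suc i} i<k = ∙-cancelʳ (P i) _ _ (begin
      X (k ℕ.+ k ℕ.+ suc i) + P i
        ≡⟨ cong (X (k ℕ.+ k ℕ.+ suc i) +_) (fol₁ (ℕ.<⇒≤ i<k)) ⟨
      X (k ℕ.+ k ℕ.+ suc i) + X i
        ≡⟨ bal₂ i<k ⟩
      X (k ℕ.+ suc i) + X (k ℕ.+ i)
        ≡⟨ cong₂ _+_ (trans (fol₂ i<k) (cong (_+ P (suc i)) (shift₁ i))) (fol₂ (ℕ.<⇒≤ i<k)) ⟩
      (P i + P (suc i)) + (P (k ℕ.+ i) + P i)
        ≡⟨ solve 3 (λ a b c → (b :+ c) :+ (a :+ b) := a :+ b :+ c :+ b) refl (P (k ℕ.+ i)) (P i) (P (suc i)) ⟩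
      (P (k ℕ.+ i) + P i + P (suc i)) + P i
        ≡⟨ cong (_+ P i) (shift₃ i) ⟨
      (P (k ℕ.+ k ℕ.+ suc i) + P (k ℕ.+ suc i) + P (suc i)) + P i ∎)

  P-period4 : Period P 4
  P-period4 = balanced⇒period4 follows balanced

-- Kernel vectors built from periodic functions.

-- The X with Follows k P X; the bounds in χ are strict, so that P 0 ≡ 0 is what makes the
-- pieces agree at k and 2k.
unfold : ℕ → (ℕ → ℚ) → ℕ → ℚ
unfold k P m = P m + χ k m * P (m ∸ k) + χ (k ℕ.+ k) m * P (m ∸ (k ℕ.+ k))

χ-≥ : ∀ {a m} → m ≤ a → χ a m ≡ 0ℚ
χ-≥ {m = zero}            _         = refl
χ-≥ {suc a} {m = suc m} (s≤s m≤a) = χ-≥ m≤a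

χ-≥-* : ∀ {a m} p → m ≤ a → χ a m * p ≡ 0ℚ
χ-≥-* p m≤a = trans (cong (_* p) (χ-≥ m≤a)) (ℚ.*-zeroˡ p)

χ-< : ∀ a i → χ a (a ℕ.+ suc i) ≡ 1ℚ
χ-< zero    i = refl
χ-< (suc a) i = χ-< a i

-- The indicator is 1 except at `i = 0`, where it is 0 but `P 0` vanishes as well.
χ-gate : ∀ (P : ℕ → ℚ) → P 0 ≡ 0ℚ → ∀ a i → χ a (a ℕ.+ i) * P (a ℕ.+ i ∸ a) ≡ P i
χ-gate P P0≡0 a i = trans (cong (λ z → χ a (a ℕ.+ i) * P z) (ℕ.m+n∸m≡n a i)) (gate i)
  where
  gate : ∀ i → χ a (a ℕ.+ i) * P i ≡ P i
  gate zero    = trans (cong (χ a (a ℕ.+ 0) *_) P0≡0) (trans (ℚ.*-zeroʳ (χ a (a ℕ.+ 0))) (sym P0≡0))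
  gate (suc i) = trans (cong (_* P (suc i)) (χ-< a i)) (ℚ.*-identityˡ (P (suc i)))

unfold-follows : ∀ k P → P 0 ≡ 0ℚ → Follows k P (unfold k P)
unfold-follows k P P0≡0 = record
  { fol₁ = λ {i} i≤k → begin
      P i + χ k i * P (i ∸ k) + χ (k ℕ.+ k) i * P (i ∸ (k ℕ.+ k))
        ≡⟨ cong₂ (λ a b → P i + a + b) (χ-≥-* _ i≤k) (χ-≥-* _ (ℕ.m≤n⇒m≤o+n k i≤k)) ⟩
      P i + 0ℚ + 0ℚ
        ≡⟨ trans (ℚ.+-identityʳ _) (ℚ.+-identityʳ _) ⟩
      P i ∎
  ; fol₂ = λ {i} i≤k → begin
      P (k ℕ.+ i) + χ k (k ℕ.+ i) * P (k ℕ.+ i ∸ k) + χ (k ℕ.+ k) (k ℕ.+ i) * P (k ℕ.+ i ∸ (k ℕ.+ k))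
        ≡⟨ cong₂ (λ a b → P (k ℕ.+ i) + a + b) (χ-gate P P0≡0 k i) (χ-≥-* _ (ℕ.+-monoʳ-≤ k i≤k)) ⟩
      P (k ℕ.+ i) + P i + 0ℚ
        ≡⟨ ℚ.+-identityʳ _ ⟩
      P (k ℕ.+ i) + P i ∎
  ; fol₃ = λ {i} _ → cong₂ (λ a b → P (k ℕ.+ k ℕ.+ i) + a + b)
      (trans (cong (λ m → χ k m * P (m ∸ k)) (ℕ.+-assoc k k i)) (χ-gate P P0≡0 k (k ℕ.+ i)))
      (χ-gate P P0≡0 (k ℕ.+ k) i)
  }

unfold-0 : ∀ k P → P 0 ≡ 0ℚ → unfold k P 0 ≡ 0ℚ
unfold-0 k P P0≡0 = trans (Follows.fol₁ (unfold-follows k P P0≡0) z≤n) P0≡0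

unfold-cong : ∀ k {P Q} → (∀ n → P n ≡ Q n) → ∀ m → unfold k P m ≡ unfold k Q m
unfold-cong k P≡Q m = cong₂ _+_ (cong₂ _+_ (P≡Q m) (cong (χ k m *_) (P≡Q _))) (cong (χ (k ℕ.+ k) m *_) (P≡Q _))

unfold-linear : ∀ k {d} (c : Vector ℚ d) (Q : Fin d → ℕ → ℚ) m →
                c ∙ (λ s → unfold k (Q s) m) ≡ unfold k (λ n → c ∙ (λ s → Q s n)) m
unfold-linear k c Q m = begin
  c ∙ (λ s → Q s m + u * Q s (m ∸ k) + w * Q s (m ∸ (k ℕ.+ k)))
    ≡⟨ ∙-distribˡ-+ c (λ s → Q s m + u * Q s (m ∸ k)) (λ s → w * Q s (m ∸ (k ℕ.+ k))) ⟩
  c ∙ (λ s → Q s m + u * Q s (m ∸ k)) + c ∙ (λ s → w * Q s (m ∸ (k ℕ.+ k)))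
    ≡⟨ cong₂ _+_ (trans (∙-distribˡ-+ c (λ s → Q s m) (λ s → u * Q s (m ∸ k)))
                        (cong (c ∙ (λ s → Q s m) +_) (∙-scaleʳ c u (λ s → Q s (m ∸ k)))))
                 (∙-scaleʳ c w (λ s → Q s (m ∸ (k ℕ.+ k)))) ⟩
  unfold k (λ n → c ∙ (λ s → Q s n)) m ∎
  where
  u = χ k m
  w = χ (k ℕ.+ k) m

kernelVector : ∀ k → (ℕ → ℚ) → Vector ℚ (3 ℕ.* k)
kernelVector k P = differences (3 ℕ.* k) (unfold k P)

prefixSum-kernelVector : ∀ k P {m} → P 0 ≡ 0ℚ → m ≤ 3 ℕ.* k → prefixSum (kernelVector k P) m ≡ unfold k P m
prefixSum-kernelVector k P {m} P0≡0 m≤3k = begin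
  prefixSum (kernelVector k P) m ≡⟨ prefixSum-differences (unfold k P) m≤3k ⟩
  unfold k P m - unfold k P 0    ≡⟨ cong (λ z → unfold k P m - z) (unfold-0 k P P0≡0) ⟩
  unfold k P m - 0ℚ              ≡⟨ ℚ.+-identityʳ _ ⟩
  unfold k P m                   ∎

kernelVector-inKernel : ∀ k P → P 0 ≡ 0ℚ → Period P (suc k) → Period P 4 →
                        InKernel (A (3 ℕ.* k) k) (kernelVector k P)
kernelVector-inKernel k P P0≡0 per per4 =
  balanced⇒inKernel (kernelVector k P) (Cyclic.period4⇒balanced P0≡0 per follows per4)
  where
  open Follows (unfold-follows k P P0≡0)
  k+k≤3k : k ℕ.+ k ≤ 3 ℕ.* k
  k+k≤3k = ℕ.+-monoʳ-≤ k (ℕ.m≤m+n k _)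
  follows : Follows k P (prefixSum (kernelVector k P))
  follows = record
    { fol₁ = λ i≤k → trans (prefixSum-kernelVector k P P0≡0 (ℕ.m≤n⇒m≤n+o _ i≤k)) (fol₁ i≤k)
    ; fol₂ = λ i≤k → trans (prefixSum-kernelVector k P P0≡0 (ℕ.≤-trans (ℕ.+-monoʳ-≤ k i≤k) k+k≤3k)) (fol₂ i≤k)
    ; fol₃ = λ i≤k → trans (prefixSum-kernelVector k P P0≡0
               (ℕ.≤-trans (ℕ.+-monoʳ-≤ (k ℕ.+ k) i≤k) (ℕ.≤-reflexive (sym (3*k≡k+k+k k))))) (fol₃ i≤k)
    }

-- A kernel basis indexed by the nonzero residues modulo gcd(4, k+1).

module Basis (k : ℕ) {d : ℕ} (g : GCD 4 (suc k) (suc d)) where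

  -- The indicator of the residue class of `suc s` modulo the gcd `suc d`. Class 0 is left out
  -- because the functions must vanish at 0, which leaves `d` of them.
  Q : Fin d → ℕ → ℚ
  Q s n = identity (suc d) (suc s) (n mod suc d)

  Q-period : ∀ s → Period (Q s) (suc d)
  Q-period s n = cong (identity (suc d) (suc s)) (toℕ-injective (begin
    toℕ ((suc d ℕ.+ n) mod suc d) ≡⟨ toℕ-fromℕ< (m%n<n (suc d ℕ.+ n) (suc d)) ⟩
    (suc d ℕ.+ n) % suc d         ≡⟨ cong (_% suc d) (ℕ.+-comm (suc d) n) ⟩
    (n ℕ.+ suc d) % suc d         ≡⟨ [m+n]%n≡m%n n (suc d) ⟩
    n % suc d                     ≡⟨ toℕ-fromℕ< (m%n<n n (suc d)) ⟨
    toℕ (n mod suc d)             ∎))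

  combination : Vector ℚ d → ℕ → ℚ
  combination c n = c ∙ (λ s → Q s n)

  combination-mod : ∀ c n → combination c n ≡ (0ℚ ∷ c) (n mod suc d)
  combination-mod c n = at (n mod suc d)
    where
    at : ∀ r → c ∙ (λ s → identity (suc d) (suc s) r) ≡ (0ℚ ∷ c) r
    at zero    = ∙-zeroʳ c
    at (suc t) = ∙-identityʳ c t

  combination-toℕ : ∀ c s → combination c (suc (toℕ s)) ≡ c s
  combination-toℕ c s = trans (combination-mod c (suc (toℕ s))) (cong (0ℚ ∷ c) (toℕ-injective (begin
    toℕ (suc (toℕ s) mod suc d) ≡⟨ toℕ-fromℕ< (m%n<n (suc (toℕ s)) (suc d)) ⟩
    suc (toℕ s) % suc d         ≡⟨ m≤n⇒m%n≡m (toℕ<n s) ⟩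
    suc (toℕ s)                 ∎)))

  basis : Fin d → Vector ℚ (3 ℕ.* k)
  basis s = kernelVector k (Q s)

  linearCombination-basis : ∀ c j → linearCombination c basis j ≡ kernelVector k (combination c) j
  linearCombination-basis c j = begin
    c ∙ (λ s → unfold k (Q s) (suc m) - unfold k (Q s) m)
      ≡⟨ ∙-distribˡ-- c (λ s → unfold k (Q s) (suc m)) (λ s → unfold k (Q s) m) ⟩
    c ∙ (λ s → unfold k (Q s) (suc m)) - c ∙ (λ s → unfold k (Q s) m)
      ≡⟨ cong₂ _-_ (unfold-linear k c Q (suc m)) (unfold-linear k c Q m) ⟩
    kernelVector k (combination c) j ∎
    where m = toℕ j

  -- Places the residues 1, ..., d in the first block, where prefix sums agree with the periodic
  -- function and the coefficients can be read off.
  d≤k : d ≤ k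
  d≤k = ℕ.s≤s⁻¹ (∣⇒≤ (GCD.gcd∣n g))

  independent : LinearlyIndependent basis
  independent c lc≡0 s = begin
    c s                                             ≡⟨ combination-toℕ c s ⟨
    combination c m                                 ≡⟨ Follows.fol₁ (unfold-follows k (combination c) C0≡0) m≤k ⟨
    unfold k (combination c) m                      ≡⟨ prefixSum-kernelVector k (combination c) C0≡0 (ℕ.m≤n⇒m≤n+o _ m≤k) ⟨
    prefixSum (kernelVector k (combination c)) m    ≡⟨ ∙-congʳ (λ j → χ (toℕ j) m) (λ j → trans (sym (linearCombination-basis c j)) (lc≡0 j)) ⟩
    (λ j → χ (toℕ {3 ℕ.* k} j) m) ∙ (λ _ → 0ℚ)      ≡⟨ ∙-zeroʳ (λ j → χ (toℕ {3 ℕ.* k} j) m) ⟩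
    0ℚ                                              ∎
    where
    m = suc (toℕ s)
    m≤k : m ≤ k
    m≤k = ℕ.≤-trans (toℕ<n s) d≤k
    C0≡0 : combination c 0 ≡ 0ℚ
    C0≡0 = combination-mod c 0

  -- The function `P` obtained from `x` has periods 4 and k+1, hence their gcd, so it is determined
  -- by its values at the residues. It vanishes at residue 0, and the other values are the
  -- coefficients.
  spanning : ∀ x → InKernel (A (3 ℕ.* k) k) x → ∃[ c ] (∀ j → linearCombination c basis j ≡ x j)
  spanning x Ax≡0 = c , λ j → begin
    linearCombination c basis j      ≡⟨ linearCombination-basis c j ⟩
    kernelVector k (combination c) j ≡⟨ cong₂ _-_ (unfold-cong k combination≡P (suc (toℕ j))) (unfold-cong k combination≡P (toℕ j)) ⟩
    kernelVector k P j               ≡⟨ follows-unique (unfold-follows k P P0≡0) follows (toℕ<n j) ⟩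
    X (suc (toℕ j)) - X (toℕ j)      ≡⟨ prefixSum-step x j ⟩
    x j                              ∎
    where
    X = prefixSum x
    P0≡0 = prefixSum-0 x
    open FromBalanced {k} {X} P0≡0 (inKernel⇒balanced x Ax≡0)
    c : Vector ℚ d
    c s = P (suc (toℕ s))
    combination≡P : ∀ n → combination c n ≡ P n
    combination≡P n = begin
      combination c n       ≡⟨ combination-mod c n ⟩
      (0ℚ ∷ c) (n mod suc d) ≡⟨ at (n mod suc d) ⟩
      P (toℕ (n mod suc d)) ≡⟨ cong P (toℕ-fromℕ< (m%n<n n (suc d))) ⟩
      P (n % suc d)         ≡⟨ period-% {P} (period-gcd g P-period4 P-period) n ⟨
      P n                   ∎
      where
      at : ∀ r → (0ℚ ∷ c) r ≡ P (toℕ r)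
      at zero    = sym P0≡0
      at (suc s) = refl

  isKernelBasis : IsKernelBasis (A (3 ℕ.* k) k) basis
  isKernelBasis = record
    -- `refl` suffices for `Q s 0`: residue 0 is never of the form `suc s`, and this computes.
    { inKernel    = λ s → kernelVector-inKernel k (Q s) refl
                      (period-∣ (GCD.gcd∣n g) (Q-period s)) (period-∣ (GCD.gcd∣m g) (Q-period s))
    ; independent = independent
    ; spanning    = spanning
    }

nullity : ∀ k {d} → GCD 4 (suc k) (suc d) → HasNullity (A (3 ℕ.* k) k) d
nullity k g = Basis.basis k g , Basis.isKernelBasis k g

-- Every kernel vector is a combination of no vectors, and the empty sum computes to `0ℚ`.
nullity0⇒trivialKernel : ∀ {m n} {M : Matrix m n} → HasNullity M 0 → TrivialKernel M
nullity0⇒trivialKernel (_ , basis) x Mx≡0 j = sym (proj₂ (IsKernelBasis.spanning basis x Mx≡0) j)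

-- The gcd of 4 and k+1 by residue of k.

∣4∧∣4q+2⇒∣2 : ∀ {e} q → e ∣ 4 → e ∣ q ℕ.* 4 ℕ.+ 2 → e ∣ 2
∣4∧∣4q+2⇒∣2 q e∣4 e∣4q+2 = ∣m+n∣m⇒∣n e∣4q+2 (∣n⇒∣m*n q e∣4)

-- For k = 2q, 2(k+1) = 4q + 2, so a common divisor of 4 and k+1 divides 2, hence k, hence 1.
gcd-even : ∀ {k} → 2 ∣ k → GCD 4 (suc k) 1
gcd-even {k} (divides q refl) = GCD.is (1∣ 4 , 1∣ suc k) greatest
  where
  greatest : ∀ {e} → e ∣ 4 × e ∣ suc k → e ∣ 1
  greatest {e} (e∣4 , e∣1+k) = ∣m+n∣m⇒∣n (subst (e ∣_) (ℕ.+-comm 1 k) e∣1+k) (∣n⇒∣m*n q e∣2)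
    where
    double : 2 ℕ.* suc (q ℕ.* 2) ≡ q ℕ.* 4 ℕ.+ 2
    double = begin
      2 ℕ.* suc (q ℕ.* 2)      ≡⟨ ℕ.*-suc 2 (q ℕ.* 2) ⟩
      2 ℕ.+ 2 ℕ.* (q ℕ.* 2)    ≡⟨ ℕ.+-comm 2 _ ⟩
      2 ℕ.* (q ℕ.* 2) ℕ.+ 2    ≡⟨ cong (ℕ._+ 2) (ℕ.*-comm 2 (q ℕ.* 2)) ⟩
      q ℕ.* 2 ℕ.* 2 ℕ.+ 2      ≡⟨ cong (ℕ._+ 2) (ℕ.*-assoc q 2 2) ⟩
      q ℕ.* 4 ℕ.+ 2            ∎
    e∣2 : e ∣ 2
    e∣2 = ∣4∧∣4q+2⇒∣2 q e∣4 (subst (e ∣_) double (∣n⇒∣m*n 2 e∣1+k))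

suc-split : ∀ {r} k → k % 4 ≡ r → suc k ≡ k / 4 ℕ.* 4 ℕ.+ suc r
suc-split {r} k k%4≡r = begin
  suc k                          ≡⟨ cong suc (m≡m%n+[m/n]*n k 4) ⟩
  suc (k % 4) ℕ.+ k / 4 ℕ.* 4    ≡⟨ cong (λ z → suc z ℕ.+ k / 4 ℕ.* 4) k%4≡r ⟩
  suc r ℕ.+ k / 4 ℕ.* 4          ≡⟨ ℕ.+-comm (suc r) (k / 4 ℕ.* 4) ⟩
  k / 4 ℕ.* 4 ℕ.+ suc r          ∎

gcd-1mod4 : ∀ k → k % 4 ≡ 1 → GCD 4 (suc k) 2
gcd-1mod4 k k%4≡1 = subst (λ n → GCD 4 n 2) (sym (suc-split k k%4≡1))
  (GCD.is (2∣4 , ∣m∣n⇒∣m+n (∣n⇒∣m*n (k / 4) 2∣4) ∣-refl)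
          (λ (e∣4 , e∣n) → ∣4∧∣4q+2⇒∣2 (k / 4) e∣4 e∣n))
  where
  2∣4 : 2 ∣ 4
  2∣4 = divides 2 refl

gcd-3mod4 : ∀ k → k % 4 ≡ 3 → GCD 4 (suc k) 4
gcd-3mod4 k k%4≡3 = subst (λ n → GCD 4 n 4) (sym (suc-split k k%4≡3))
  (GCD.is (∣-refl , ∣m∣n⇒∣m+n (∣n⇒∣m*n (k / 4) ∣-refl) ∣-refl) proj₁)

theorem8p9 : (k : ℕ) → k ≥ 1 →
    (2 ∣ k → Nonsingular (A (3 ℕ.* k) k) × HasNullity (A (3 ℕ.* k) k) 0)
    × (k % 4 ≡ 1 → HasNullity (A (3 ℕ.* k) k) 1)
    × (k % 4 ≡ 3 → HasNullity (A (3 ℕ.* k) k) 3)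
theorem8p9 k _ = even , (λ k%4≡1 → nullity k (gcd-1mod4 k k%4≡1)) , (λ k%4≡3 → nullity k (gcd-3mod4 k k%4≡3))
  where
  even : 2 ∣ k → Nonsingular (A (3 ℕ.* k) k) × HasNullity (A (3 ℕ.* k) k) 0
  even 2∣k = trivialKernel⇒nonsingular _ (nullity0⇒trivialKernel N≡0) , N≡0
    where
    N≡0 : HasNullity (A (3 ℕ.* k) k) 0
    N≡0 = nullity k (gcd-even 2∣k)
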